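{- Let $(\mathsf P,\mathcal O)$ be a semitopology and $p\in\mathsf P$. If $p\in K(p)$ (i.e. $p$ is weakly regular), then $\overline{K(p)}=I(p)$. In particular this holds whenever $p$ is regular.
   Context: A semitopology is a pair $(\mathsf P,\mathcal O)$ where $\mathsf P$ is a set and $\mathcal O\subseteq\mathcal P(\mathsf P)$ contains $\varnothing$ and $\mathsf P$ and is closed under arbitrary unions. Points $p,p'$ are intertwined when every open set containing $p$ intersects every open set containing $p'$; $I(p)$ is the set of points intertwined with $p$; $K(p)=\mathrm{int}(I(p))$, where $\mathrm{int}(R)$ is the union of all open subsets of $R$. The closure $\overline R$ is the set of points $q$ such that every open set containing $q$intersects $R$. A set $T$ is topen when it is nonempty, open, and for all open $O,O'$, $O\cap T\neq\varnothing\neq T\cap O'$ implies $O\cap O'\neq\varnothing$; $p$ is regular when $p\in K(p)$ and $K(p)$ is topen. -}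

module Defs where

open import Level using (Level; _⊔_) renaming (suc to lsuc)
open import Data.Product using (Σ-syntax; _×_; proj₁; proj₂)
open import Relation.Unary using (Pred; _∈_; _⊆_; _≐_; _≬_; ∅; U; ⋃; Satisfiable)

-- Subsets of the point set are predicates, equal when mutually included (_≐_).
-- Nonemptiness of a subset or an intersection is read as inhabitedness.
--
-- The levels are independent: open sets are taken among predicates of level ℓ,
-- and unions range over families indexed by types of level s.  Agda is
-- predicative, so the union of all the open subsets of a given set lives
-- above level ℓ; hence openness of a predicate of arbitrary level means
-- having the same elements as some member of 𝒪.  When s is large enough
-- (see interior-open) every interior is open in this sense.
record Semitopology (a ℓ o s : Level) : Set (lsuc (a ⊔ ℓ ⊔ o ⊔ s)) where
  field
    Point : Set a
    𝒪     : Pred (Pred Point ℓ) o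

  Open : ∀ {r} → Pred Point r → Set (a ⊔ lsuc ℓ ⊔ o ⊔ r)
  Open R = Σ[ O ∈ Pred Point ℓ ] O ∈ 𝒪 × O ≐ R

  field
    ∅-open : Open ∅
    U-open : Open U
    ⋃-open : (J : Set s) (O : J → Pred Point ℓ) → (∀ j → O j ∈ 𝒪) → Open (⋃ J O)

  Intertwined : Point → Point → Set (a ⊔ lsuc ℓ ⊔ o)
  Intertwined p p′ = ∀ O O′ → O ∈ 𝒪 → O′ ∈ 𝒪 → p ∈ O → p′ ∈ O′ → O ≬ O′

  I : Point → Pred Point (a ⊔ lsuc ℓ ⊔ o)
  I p p′ = Intertwined p p′

  OpenSubset : ∀ {r} → Pred Point r → Set (a ⊔ lsuc ℓ ⊔ o ⊔ r)
  OpenSubset R = Σ[ O ∈ Pred Point ℓ ] O ∈ 𝒪 × O ⊆ R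

  interior : ∀ {r} → Pred Point r → Pred Point (a ⊔ lsuc ℓ ⊔ o ⊔ r)
  interior R = ⋃ (OpenSubset R) proj₁

  K : Point → Pred Point (a ⊔ lsuc ℓ ⊔ o)
  K p = interior (I p)

  closure : ∀ {r} → Pred Point r → Pred Point (a ⊔ lsuc ℓ ⊔ o ⊔ r)
  closure R q = ∀ O → O ∈ 𝒪 → q ∈ O → O ≬ R

  Topen : ∀ {r} → Pred Point r → Set (a ⊔ lsuc ℓ ⊔ o ⊔ r)
  Topen T = Satisfiable T × Open T ×
            (∀ O O′ → O ∈ 𝒪 → O′ ∈ 𝒪 → O ≬ T → T ≬ O′ → O ≬ O′)

  WeaklyRegular : Point → Set (a ⊔ lsuc ℓ ⊔ o)
  WeaklyRegular p = p ∈ K p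

  Regular : Point → Set (a ⊔ lsuc ℓ ⊔ o)
  Regular p = p ∈ K p × Topen (K p)

module _ {a ℓ o s} (S : Semitopology a ℓ o (a ⊔ lsuc ℓ ⊔ o ⊔ s)) where
  open Semitopology S

  interior-open : (R : Pred Point (a ⊔ lsuc ℓ ⊔ o ⊔ s)) → Open (interior R)
  interior-open R = ⋃-open (OpenSubset R) proj₁ (λ V → proj₁ (proj₂ V))

{-# OPTIONS --safe #-}
module Submission where

open import Level using (Level)
open import Data.Product using (_×_; _,_; proj₁)
open import Relation.Unary using (_≐_; _⊆_)
open import Defs

-- Being intertwined with `p` is a closed condition, so the closure of `K p` stays in `I p` for
-- every `p`. Conversely, weak regularity makes `K p` contain an open neighbourhood of `p`, which
-- every neighbourhood of a point intertwined with `p` must meet.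

module _ {a ℓ o s : Level} (S : Semitopology a ℓ o s) where
  open Semitopology S

  closure-K⊆I : ∀ p → closure (K p) ⊆ I p
  closure-K⊆I p q∈cl O O′ O∈𝒪 O′∈𝒪 p∈O q∈O′ with q∈cl O′ O′∈𝒪 q∈O′
  -- `O′` is a neighbourhood of `r` as well as of `q`, and `r` is intertwined with `p`.
  ... | r , r∈O′ , (_ , _ , V⊆I) , r∈V = V⊆I r∈V O O′ O∈𝒪 O′∈𝒪 p∈O r∈O′

  weaklyRegular⇒I⊆closure-K : ∀ p → WeaklyRegular p → I p ⊆ closure (K p)
  weaklyRegular⇒I⊆closure-K p (W@(V , V∈𝒪 , _) , p∈V) q∈I O O∈𝒪 q∈O with q∈I V O V∈𝒪 O∈𝒪 p∈V q∈O
  -- The open subset `W` of `I p` that puts `p` in `K p` also puts `r` there.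
  ... | r , r∈V , r∈O = r , r∈O , W , r∈V

  weaklyRegular⇒closure-K≐I : ∀ p → WeaklyRegular p → closure (K p) ≐ I p
  weaklyRegular⇒closure-K≐I p wr =
    (λ {q} → closure-K⊆I p {q}) , (λ {q} → weaklyRegular⇒I⊆closure-K p wr {q})

theorem5p17 : ∀ {a ℓ o s : Level} (S : Semitopology a ℓ o s) (p : Semitopology.Point S) →
    let open Semitopology S in
    (WeaklyRegular p → closure (K p) ≐ I p) × (Regular p → closure (K p) ≐ I p)
theorem5p17 S p = wr , λ reg → wr (proj₁ reg)
  where wr = weaklyRegular⇒closure-K≐I S p
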